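{- Let $q$ be an odd prime. Let $p$ be a prime such that $p\equiv 3 \pmod 4$ and $p\equiv 1 \pmod q$. For $k=1,\dots,q$ put $$\Pi_{k}^{(q)}=\prod_{j=(k-1)(p-1)/q+1}^{k(p-1)/q}j .$$ Then the integer $$\prod_{\substack{1\le k\le (q-1)/2\\ (q+1)/2 -k \equiv 1 \bmod 2}}\Pi_{k}^{(q)}$$ is a quadratic residue modulo $p$.
   Context: Quadratic residue modulo $p$ means a nonzero square in $\mathbb{Z}/p\mathbb{Z}$. Since $p\equiv 1 \pmod q$, the number $(p-1)/q$ is an integer, so the products $\Pi_k^{(q)}$ are over consecutive blocks of $(p-1)/q$ integers in $\{1,\dots,p-1\}$. -}

module Defs where

open import Data.List.Base using (List; applyUpTo; filter; map)
open import Data.Nat.Base using (ℕ; suc; NonZero; _+_; _*_; _∸_; _/_; ∣_-_∣)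
open import Data.Nat.Divisibility using (_∣_; _∣?_)
open import Data.Nat.ListAction using (product)
open import Data.Product.Base using (_×_; ∃-syntax)
open import Relation.Nullary.Decidable.Core using (Dec)
open import Relation.Nullary.Negation.Core using (¬_)

infix 4 _≡_[mod_] _≡?_[mod_]

_≡_[mod_] : ℕ → ℕ → ℕ → Set
a ≡ b [mod n ] = n ∣ ∣ a - b ∣

_≡?_[mod_] : ∀ a b n → Dec (a ≡ b [mod n ])
a ≡? b [mod n ] = n ∣? ∣ a - b ∣

-- The class of a is a nonzero square in ℤ/nℤ; for n > 0, natural numbers
-- represent every residue class, so x need only range over ℕ.
IsQuadraticResidue : (n a : ℕ) → Set
IsQuadraticResidue n a = ¬ (a ≡ 0 [mod n ]) × (∃[ x ] x * x ≡ a [mod n ])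

-- a, a + 1, …, b; empty if b < a.
interval : ℕ → ℕ → List ℕ
interval a b = applyUpTo (a +_) (suc b ∸ a)

-- Meant for k ≥ 1 and p ≥ 1, so that the subtractions are exact.
-- Since _*_ and _/_ associate to the left, the bounds are ((k - 1)(p - 1))/q + 1
-- and (k(p - 1))/q, with both divisions exact when q ∣ p - 1.
Π : (q : ℕ) .{{_ : NonZero q}} (p k : ℕ) → ℕ
Π q p k = product (interval ((k ∸ 1) * (p ∸ 1) / q + 1) (k * (p ∸ 1) / q))

-- For k in the range, k ≤ (q - 1)/2 < (q + 1)/2 when q is odd, so _∸_ is exact.
indices : ℕ → List ℕ
indices q = filter (λ k → ((q + 1) / 2 ∸ k) ≡? 1 [mod 2 ]) (interval 1 ((q ∸ 1) / 2))

∏Π : (q : ℕ) .{{_ : NonZero q}} (p : ℕ) → ℕ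
∏Π q p = product (map (Π q p) (indices q))

{-# OPTIONS --safe #-}

-- Write χ for the Legendre symbol mod p, q = 2h + 1, m = (p - 1)/q, M for the sum of
-- jχ(j) over 0 < j < p, and S k (0 ≤ k < q) for the sum of χ over the k-th block of m
-- integers.  For j in that block qj = kp + r with 0 < r < p, so summing χ(r)r gives
-- (q - χ(q))M = p ∑ k S(k) = -2pV, where V = ∑_{k<h} (h - k) S(k), because -1 is a
-- nonresidue and hence S(2h - k) = -S(k).  A sum of n signs with product s is congruent
-- to n + s - 1 mod 4; only the blocks with h - k odd, which are those in the statement,
-- survive in V ≡ m h(h+1)/2 + χ(P) - 1 mod 4, P being their product.  Since M, p and m/2
-- are odd, χ(P) = -1 would contradict parity.  So P^((p-1)/2) ≡ 1, and P^((p+1)/4) is a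
-- square root of P.
module Submission where

open import Defs
open import Data.Empty using (⊥-elim)
open import Data.Integer.Base as ℤ using (ℤ; +_; 0ℤ; 1ℤ; -1ℤ; _+_; _*_; _-_; -_; _^_)
open import Data.Integer.Divisibility.Signed as ℤ
  using (divides) renaming (_∣_ to _∣ᶻ_; _∣?_ to _∣ᶻ?_)
import Data.Integer.Properties as ℤ
open import Data.Integer.Tactic.RingSolver using (solve-∀)
open import Data.List.Base using (applyUpTo; filter; map)
open import Data.List.Properties using (filter-accept; filter-reject)
open import Data.Nat.Base as ℕ using (ℕ; zero; suc; z≤n; s≤s; _<_; _≤_; ∣_-_∣)
open import Data.Nat.Combinatorics using (_C_; nCn≡1; nCk+nC[k+1]≡[n+1]C[k+1]; nCk≡nC[n∸k])
open import Data.Nat.Combinatorics.Specification using (k>n⇒nCk≡0)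
open import Data.Nat.Divisibility as ℕ using (_∣_; _∤_; ∣⇒≤)
open import Data.Nat.DivMod using (m*n/n≡m)
open import Data.Nat.ListAction using (product)
open import Data.Nat.Primality using (Prime; prime[2]; prime⇒nonZero; euclidsLemma)
import Data.Nat.Properties as ℕ
import Data.Nat.Tactic.RingSolver as ℕRing
open import Data.Product.Base using (_×_; _,_; proj₁; proj₂; ∃-syntax)
open import Data.Sum.Base as Sum using (_⊎_; inj₁; inj₂)
open import Function.Base using (_∘_)
open import Level using (0ℓ)
open import Relation.Binary.Bundles using (Setoid)
open import Relation.Binary.PropositionalEquality
import Relation.Binary.Reasoning.Setoid as SetoidReasoning
open import Relation.Nullary.Decidable.Core using (Dec; yes; no)
open import Relation.Nullary.Negation.Core using (¬_)
open import Relation.Unary using (Pred; Decidable)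

-- Congruences and finite sums of integers

infix 4 _≡ᶻ_[mod_]

-- A record rather than a synonym for the divisibility: `a - b` would unfold, whereas the record
-- keeps both sides of a congruence recoverable from its type.
record _≡ᶻ_[mod_] (a b n : ℤ) : Set where
  constructor congruent
  field difference : n ∣ᶻ a - b

open _≡ᶻ_[mod_]

module _ {n : ℤ} where

  ≡ᶻ-refl : ∀ {a} → a ≡ᶻ a [mod n ]
  ≡ᶻ-refl {a} = congruent (divides 0ℤ (ℤ.+-inverseʳ a))

  ≡ᶻ-reflexive : ∀ {a b} → a ≡ b → a ≡ᶻ b [mod n ]
  ≡ᶻ-reflexive refl = ≡ᶻ-refl

  ≡ᶻ-sym : ∀ {a b} → a ≡ᶻ b [mod n ] → b ≡ᶻ a [mod n ]
  ≡ᶻ-sym {a} {b} (congruent d) = congruent (subst (n ∣ᶻ_) (identity a b) (ℤ.∣m⇒∣-m d))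
    where identity : ∀ a b → - (a - b) ≡ b - a
          identity = solve-∀

  ≡ᶻ-trans : ∀ {a b c} → a ≡ᶻ b [mod n ] → b ≡ᶻ c [mod n ] → a ≡ᶻ c [mod n ]
  ≡ᶻ-trans {a} {b} {c} (congruent d) (congruent e) =
    congruent (subst (n ∣ᶻ_) (identity a b c) (ℤ.∣m∣n⇒∣m+n d e))
    where identity : ∀ a b c → (a - b) + (b - c) ≡ a - c
          identity = solve-∀

  +-cong : ∀ {a b c d} → a ≡ᶻ b [mod n ] → c ≡ᶻ d [mod n ] → a + c ≡ᶻ b + d [mod n ]
  +-cong {a} {b} {c} {d} (congruent x) (congruent y) =
    congruent (subst (n ∣ᶻ_) (identity a b c d) (ℤ.∣m∣n⇒∣m+n x y))
    where identity : ∀ a b c d → (a - b) + (c - d) ≡ (a + c) - (b + d)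
          identity = solve-∀

  *-cong : ∀ {a b c d} → a ≡ᶻ b [mod n ] → c ≡ᶻ d [mod n ] → a * c ≡ᶻ b * d [mod n ]
  *-cong {a} {b} {c} {d} (congruent x) (congruent y) =
    congruent (subst (n ∣ᶻ_) (identity a b c d)
      (ℤ.∣m∣n⇒∣m+n (ℤ.∣m⇒∣m*n c x) (ℤ.∣n⇒∣m*n b y)))
    where identity : ∀ a b c d → (a - b) * c + b * (c - d) ≡ a * c - b * d
          identity = solve-∀

  +-congˡ : ∀ a {b c} → b ≡ᶻ c [mod n ] → a + b ≡ᶻ a + c [mod n ]
  +-congˡ a = +-cong (≡ᶻ-refl {a})

  *-congˡ : ∀ a {b c} → b ≡ᶻ c [mod n ] → a * b ≡ᶻ a * c [mod n ]
  *-congˡ a = *-cong (≡ᶻ-refl {a})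

  ^-congˡ : ∀ {a b} k → a ≡ᶻ b [mod n ] → a ^ k ≡ᶻ b ^ k [mod n ]
  ^-congˡ zero    d = ≡ᶻ-refl
  ^-congˡ (suc k) d = *-cong d (^-congˡ k d)

≡ᶻ-setoid : ℤ → Setoid 0ℓ 0ℓ
≡ᶻ-setoid n = record
  { _≈_           = _≡ᶻ_[mod n ]
  ; isEquivalence = record { refl = ≡ᶻ-refl ; sym = ≡ᶻ-sym ; trans = ≡ᶻ-trans }
  }

module ≡ᶻ-Reasoning (n : ℤ) = SetoidReasoning (≡ᶻ-setoid n)

∑ : ℕ → (ℕ → ℤ) → ℤ
∑ zero    f = 0ℤ
∑ (suc n) f = f 0 + ∑ n (f ∘ suc)

∑-cong : ∀ n {f g} → (∀ i → i < n → f i ≡ g i) → ∑ n f ≡ ∑ n g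
∑-cong zero    f≗g = refl
∑-cong (suc n) f≗g = cong₂ _+_ (f≗g 0 (s≤s z≤n)) (∑-cong n λ i i<n → f≗g (suc i) (s≤s i<n))

∑-cong-≡ᶻ : ∀ n {f g d} → (∀ i → i < n → f i ≡ᶻ g i [mod d ]) → ∑ n f ≡ᶻ ∑ n g [mod d ]
∑-cong-≡ᶻ zero    f≗g = ≡ᶻ-refl
∑-cong-≡ᶻ (suc n) f≗g =
  +-cong (f≗g 0 (s≤s z≤n)) (∑-cong-≡ᶻ n λ i i<n → f≗g (suc i) (s≤s i<n))

∑-zero : ∀ n → ∑ n (λ _ → 0ℤ) ≡ 0ℤ
∑-zero zero    = refl
∑-zero (suc n) = trans (ℤ.+-identityˡ _) (∑-zero n)

∑-linear : ∀ n a b f g → ∑ n (λ i → a * f i + b * g i) ≡ a * ∑ n f + b * ∑ n g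
∑-linear zero    a b f g = identity a b
  where identity : ∀ a b → 0ℤ ≡ a * 0ℤ + b * 0ℤ
        identity = solve-∀
∑-linear (suc n) a b f g = trans
  (cong (λ z → (a * f 0 + b * g 0) + z) (∑-linear n a b (f ∘ suc) (g ∘ suc)))
  (identity a b (f 0) (g 0) (∑ n (f ∘ suc)) (∑ n (g ∘ suc)))
  where identity : ∀ a b x y s t →
                   (a * x + b * y) + (a * s + b * t) ≡ a * (x + s) + b * (y + t)
        identity = solve-∀

∑-split : ∀ m n f → ∑ (m ℕ.+ n) f ≡ ∑ m f + ∑ n (λ i → f (m ℕ.+ i))
∑-split zero    n f = sym (ℤ.+-identityˡ _)
∑-split (suc m) n f = trans (cong (λ z → f 0 + z) (∑-split m n (f ∘ suc))) (sym (ℤ.+-assoc (f 0) _ _))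

∑-last : ∀ n f → ∑ (suc n) f ≡ ∑ n f + f n
∑-last zero    f = ℤ.+-comm (f 0) 0ℤ
∑-last (suc n) f = trans (cong (λ z → f 0 + z) (∑-last n (f ∘ suc))) (sym (ℤ.+-assoc (f 0) _ _))

-- The reflection i ↦ n - 1 - i is expressed by the relation `suc (i + j) ≡ n`, which avoids
-- truncated subtraction and hands both bounds to the caller.
∑-reverse : ∀ n {f g} → (∀ i j → suc (i ℕ.+ j) ≡ n → f i ≡ g j) → ∑ n f ≡ ∑ n g
∑-reverse zero            f~g = refl
∑-reverse (suc n) {f} {g} f~g = begin
  f 0 + ∑ n (f ∘ suc) ≡⟨ cong₂ _+_ (f~g 0 n refl) (∑-reverse n λ i j eq → f~g (suc i) j (cong suc eq)) ⟩
  g n + ∑ n g         ≡⟨ ℤ.+-comm (g n) _ ⟩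
  ∑ n g + g n         ≡⟨ ∑-last n g ⟨
  ∑ (suc n) g         ∎
  where open ≡-Reasoning

∑-blocks : ∀ k m f → ∑ (k ℕ.* m) f ≡ ∑ k (λ j → ∑ m (λ i → f (j ℕ.* m ℕ.+ i)))
∑-blocks zero    m f = refl
∑-blocks (suc k) m f = begin
  ∑ (m ℕ.+ k ℕ.* m) f                                        ≡⟨ ∑-split m (k ℕ.* m) f ⟩
  ∑ m f + ∑ (k ℕ.* m) (λ i → f (m ℕ.+ i))                    ≡⟨ cong (λ z → ∑ m f + z) (∑-blocks k m _) ⟩
  ∑ m f + ∑ k (λ j → ∑ m (λ i → f (m ℕ.+ (j ℕ.* m ℕ.+ i))))  ≡⟨ cong (λ z → ∑ m f + z)
      (∑-cong k λ j _ → ∑-cong m λ i _ → cong f (sym (ℕ.+-assoc m (j ℕ.* m) i))) ⟩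
  ∑ m f + ∑ k (λ j → ∑ m (λ i → f (m ℕ.+ j ℕ.* m ℕ.+ i)))    ∎
  where open ≡-Reasoning

∑-+ : ∀ n f g → ∑ n (λ i → f i + g i) ≡ ∑ n f + ∑ n g
∑-+ n f g = begin
  ∑ n (λ i → f i + g i)             ≡⟨ ∑-cong n (λ i _ → sym (cong₂ _+_ (ℤ.*-identityˡ (f i)) (ℤ.*-identityˡ (g i)))) ⟩
  ∑ n (λ i → 1ℤ * f i + 1ℤ * g i)   ≡⟨ ∑-linear n 1ℤ 1ℤ f g ⟩
  1ℤ * ∑ n f + 1ℤ * ∑ n g           ≡⟨ cong₂ _+_ (ℤ.*-identityˡ (∑ n f)) (ℤ.*-identityˡ (∑ n g)) ⟩
  ∑ n f + ∑ n g                     ∎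
  where open ≡-Reasoning

∑-* : ∀ n a f → ∑ n (λ i → a * f i) ≡ a * ∑ n f
∑-* zero    a f = sym (ℤ.*-zeroʳ a)
∑-* (suc n) a f = trans (cong (λ z → a * f 0 + z) (∑-* n a (f ∘ suc))) (sym (ℤ.*-distribˡ-+ a _ _))

∑-swap : ∀ m n (f : ℕ → ℕ → ℤ) → ∑ m (λ i → ∑ n (f i)) ≡ ∑ n (λ j → ∑ m (λ i → f i j))
∑-swap zero    n f = sym (∑-zero n)
∑-swap (suc m) n f =
  trans (cong (λ z → ∑ n (f 0) + z) (∑-swap m n (f ∘ suc))) (sym (∑-+ n (f 0) _))

2*∑-suc : ∀ n → + 2 * ∑ n (λ i → + suc i) ≡ + n * (1ℤ + + n)
2*∑-suc zero    = refl
2*∑-suc (suc n) = begin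
  + 2 * ∑ (suc n) (λ i → + suc i)           ≡⟨ cong (+ 2 *_) (∑-last n (λ i → + suc i)) ⟩
  + 2 * (∑ n (λ i → + suc i) + (1ℤ + + n))  ≡⟨ ℤ.*-distribˡ-+ (+ 2) (∑ n (λ i → + suc i)) _ ⟩
  + 2 * ∑ n (λ i → + suc i) + + 2 * (1ℤ + + n) ≡⟨ cong (_+ (+ 2 * (1ℤ + + n))) (2*∑-suc n) ⟩
  + n * (1ℤ + + n) + + 2 * (1ℤ + + n)       ≡⟨ identity (+ n) ⟩
  (1ℤ + + n) * (1ℤ + (1ℤ + + n))            ∎
  where
    open ≡-Reasoning
    identity : ∀ n → n * (1ℤ + n) + + 2 * (1ℤ + n) ≡ (1ℤ + n) * (1ℤ + (1ℤ + n))
    identity = solve-∀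

-- Fermat's little theorem

nC0≡1 : ∀ n → n C 0 ≡ 1
nC0≡1 n = trans (nCk≡nC[n∸k] {0} {n} z≤n) (nCn≡1 n)

-- Induction on n. In (1 + a)B the second copy of B is extended by the vanishing term at n + 1 and
-- its first term is split off; what remains is shifted by one index against aB, so Pascal's rule
-- applies termwise.
binomial-theorem : ∀ n a → (1ℤ + a) ^ n ≡ ∑ (suc n) (λ k → + (n C k) * a ^ k)
binomial-theorem zero    a = refl
binomial-theorem (suc n) a = begin
  (1ℤ + a) * (1ℤ + a) ^ n                        ≡⟨ cong ((1ℤ + a) *_) (binomial-theorem n a) ⟩
  (1ℤ + a) * B                                   ≡⟨ identity₁ a B ⟩
  a * B + (B + 0ℤ)                               ≡⟨ cong (λ z → a * B + (B + z)) top≡0 ⟨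
  a * B + (B + term n (suc n))                   ≡⟨ cong (λ z → (a * B) + z) (∑-last (suc n) (term n)) ⟨
  a * B + (term n 0 + B′)                        ≡⟨ identity₂ a B (term n 0) B′ ⟩
  term n 0 + (a * B + 1ℤ * B′)                   ≡⟨ cong (λ z → term n 0 + z) (∑-linear (suc n) a 1ℤ (term n) (term n ∘ suc)) ⟨
  term n 0 + ∑ (suc n) (λ k → a * term n k + 1ℤ * term n (suc k))
    ≡⟨ cong₂ _+_ (cong (λ c → + c * 1ℤ) (trans (nC0≡1 n) (sym (nC0≡1 (suc n)))))
                 (∑-cong (suc n) λ k _ → pascal k) ⟩
  ∑ (suc (suc n)) (term (suc n))                 ∎
  where
    open ≡-Reasoning
    term : ℕ → ℕ → ℤ
    term n k = + (n C k) * a ^ k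
    B B′ : ℤ
    B  = ∑ (suc n) (term n)
    B′ = ∑ (suc n) (term n ∘ suc)
    top≡0 : term n (suc n) ≡ 0ℤ
    top≡0 = cong (λ c → + c * a ^ suc n) (k>n⇒nCk≡0 (ℕ.n<1+n n))
    identity₁ : ∀ a b → (1ℤ + a) * b ≡ a * b + (b + 0ℤ)
    identity₁ = solve-∀
    identity₂ : ∀ a b c d → a * b + (c + d) ≡ c + (a * b + 1ℤ * d)
    identity₂ = solve-∀
    identity₃ : ∀ a x y z → a * (x * z) + 1ℤ * (y * (a * z)) ≡ (x + y) * (a * z)
    identity₃ = solve-∀
    pascal : ∀ k → a * term n k + 1ℤ * term n (suc k) ≡ term (suc n) (suc k)
    pascal k = trans (identity₃ a (+ (n C k)) (+ (n C suc k)) (a ^ k))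
      (cong (λ c → + c * a ^ suc k) (nCk+nC[k+1]≡[n+1]C[k+1] n k))

-- The absorption identity, derived from Pascal's rule by induction on n, so that no factorials have
-- to be divided.
[k+1]*[n+1]C[k+1]≡[n+1]*nCk : ∀ n k → suc k ℕ.* (suc n C suc k) ≡ suc n ℕ.* (n C k)
[k+1]*[n+1]C[k+1]≡[n+1]*nCk zero zero = refl
[k+1]*[n+1]C[k+1]≡[n+1]*nCk zero (suc k) = begin
  suc (suc k) ℕ.* (1 C suc (suc k)) ≡⟨ cong (suc (suc k) ℕ.*_) (k>n⇒nCk≡0 {1} {suc (suc k)} (s≤s (s≤s z≤n))) ⟩
  suc (suc k) ℕ.* 0                 ≡⟨ ℕ.*-zeroʳ (suc (suc k)) ⟩
  0                                 ≡⟨ k>n⇒nCk≡0 {0} {suc k} (s≤s z≤n) ⟨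
  0 C suc k                         ≡⟨ ℕ.*-identityˡ _ ⟨
  1 ℕ.* (0 C suc k)                 ∎
  where open ≡-Reasoning
[k+1]*[n+1]C[k+1]≡[n+1]*nCk (suc n) zero = begin
  1 ℕ.* (suc (suc n) C 1)        ≡⟨ cong (1 ℕ.*_) (nCk+nC[k+1]≡[n+1]C[k+1] (suc n) 0) ⟨
  1 ℕ.* ((suc n C 0) ℕ.+ (suc n C 1)) ≡⟨ identity (suc n C 0) (suc n C 1) ⟩
  (suc n C 0) ℕ.+ 1 ℕ.* (suc n C 1)   ≡⟨ cong₂ ℕ._+_ (nC0≡1 (suc n)) ([k+1]*[n+1]C[k+1]≡[n+1]*nCk n 0) ⟩
  1 ℕ.+ suc n ℕ.* (n C 0)        ≡⟨ cong (λ c → 1 ℕ.+ suc n ℕ.* c) (nC0≡1 n) ⟩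
  suc (suc n) ℕ.* 1              ≡⟨ cong (suc (suc n) ℕ.*_) (nC0≡1 (suc n)) ⟨
  suc (suc n) ℕ.* (suc n C 0)    ∎
  where
    open ≡-Reasoning
    identity : ∀ x y → 1 ℕ.* (x ℕ.+ y) ≡ x ℕ.+ 1 ℕ.* y
    identity = ℕRing.solve-∀
[k+1]*[n+1]C[k+1]≡[n+1]*nCk (suc n) (suc k) = begin
  suc (suc k) ℕ.* (suc (suc n) C suc (suc k))
    ≡⟨ cong (suc (suc k) ℕ.*_) (nCk+nC[k+1]≡[n+1]C[k+1] (suc n) (suc k)) ⟨
  suc (suc k) ℕ.* (x ℕ.+ y)
    ≡⟨ identity₁ k x y ⟩
  x ℕ.+ (suc k ℕ.* x ℕ.+ suc (suc k) ℕ.* y)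
    ≡⟨ cong (x ℕ.+_) (cong₂ ℕ._+_ ([k+1]*[n+1]C[k+1]≡[n+1]*nCk n k) ([k+1]*[n+1]C[k+1]≡[n+1]*nCk n (suc k))) ⟩
  x ℕ.+ (suc n ℕ.* (n C k) ℕ.+ suc n ℕ.* (n C suc k))
    ≡⟨ cong (x ℕ.+_) (ℕ.*-distribˡ-+ (suc n) (n C k) (n C suc k)) ⟨
  x ℕ.+ suc n ℕ.* ((n C k) ℕ.+ (n C suc k))
    ≡⟨ cong (λ z → x ℕ.+ suc n ℕ.* z) (nCk+nC[k+1]≡[n+1]C[k+1] n k) ⟩
  suc (suc n) ℕ.* x ∎
  where
    open ≡-Reasoning
    x = suc n C suc k
    y = suc n C suc (suc k)
    identity₁ : ∀ k x y → (2 ℕ.+ k) ℕ.* (x ℕ.+ y) ≡ x ℕ.+ ((1 ℕ.+ k) ℕ.* x ℕ.+ (2 ℕ.+ k) ℕ.* y)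
    identity₁ = ℕRing.solve-∀

1+n<p⇒p∤1+n : ∀ {p n} → suc n < p → p ∤ suc n
1+n<p⇒p∤1+n n<p p∣n = ℕ.<⇒≱ n<p (∣⇒≤ p∣n)

-- By absorption p divides (k + 1) C(p, k + 1), and it cannot divide k + 1 < p.
prime∣C : ∀ {n} → Prime (suc n) → ∀ k → k < n → suc n ∣ (suc n C suc k)
prime∣C {n} pr k k<n with euclidsLemma (suc k) (suc n C suc k) pr
  (subst (suc n ∣_) (sym ([k+1]*[n+1]C[k+1]≡[n+1]*nCk n k)) (ℕ.divides (n C k) (ℕ.*-comm (suc n) (n C k))))
... | inj₁ d = ⊥-elim (1+n<p⇒p∤1+n (s≤s k<n) d)
... | inj₂ d = d

-- Induction on a: modulo p only the two outer terms of the binomial expansion of (1 + a)^p survive.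
fermat : ∀ {p} → Prime p → ∀ a → (+ a) ^ p ≡ᶻ + a [mod + p ]
fermat {zero}  pr a = ⊥-elim (ℕ.NonZero.nonZero (prime⇒nonZero pr))
fermat {suc n} pr zero    = ≡ᶻ-refl
fermat {suc n} pr (suc a) = begin
  (1ℤ + + a) ^ suc n                             ≡⟨ binomial-theorem (suc n) (+ a) ⟩
  term 0 + ∑ (suc n) (term ∘ suc)                ≡⟨ cong (λ z → term 0 + z) (∑-last n (term ∘ suc)) ⟩
  term 0 + (∑ n (term ∘ suc) + term (suc n))     ≈⟨ +-congˡ (term 0) (+-cong middle (≡ᶻ-refl {a = term (suc n)})) ⟩
  term 0 + (0ℤ + term (suc n))                   ≡⟨ cong₂ (λ x y → + x * 1ℤ + (0ℤ + + y * (+ a) ^ suc n)) (nC0≡1 (suc n)) (nCn≡1 (suc n)) ⟩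
  1ℤ + (0ℤ + 1ℤ * (+ a) ^ suc n)                 ≡⟨ cong (λ z → 1ℤ + z) (trans (ℤ.+-identityˡ (1ℤ * (+ a) ^ suc n)) (ℤ.*-identityˡ ((+ a) ^ suc n))) ⟩
  1ℤ + (+ a) ^ suc n                             ≈⟨ +-congˡ 1ℤ (fermat pr a) ⟩
  1ℤ + + a                                       ∎
  where
    open ≡ᶻ-Reasoning (+ suc n)
    term : ℕ → ℤ
    term k = + (suc n C k) * (+ a) ^ k
    middle : ∑ n (term ∘ suc) ≡ᶻ 0ℤ [mod + suc n ]
    middle = begin
      ∑ n (term ∘ suc)  ≈⟨ ∑-cong-≡ᶻ n (λ k k<n → congruent (subst (+ suc n ∣ᶻ_) (sym (ℤ.+-identityʳ _))
                              (ℤ.∣m⇒∣m*n ((+ a) ^ suc k) (ℤ.∣ᵤ⇒∣ {+ suc n} {+ (suc n C suc k)} (prime∣C pr k k<n))))) ⟩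
      ∑ n (λ _ → 0ℤ)    ≡⟨ ∑-zero n ⟩
      0ℤ                ∎

^-distribʳ-* : ∀ i j n → (i * j) ^ n ≡ i ^ n * j ^ n
^-distribʳ-* i j zero    = refl
^-distribʳ-* i j (suc n) =
  trans (cong ((i * j) *_) (^-distribʳ-* i j n)) (identity i j (i ^ n) (j ^ n))
  where identity : ∀ i j x y → (i * j) * (x * y) ≡ (i * x) * (j * y)
        identity = solve-∀

-- Passing between integers and natural numbers

∣m⊖n∣≡∣m-n∣ : ∀ m n → ℤ.∣ m ℤ.⊖ n ∣ ≡ ∣ m - n ∣
∣m⊖n∣≡∣m-n∣ zero    zero    = refl
∣m⊖n∣≡∣m-n∣ zero    (suc n) = refl
∣m⊖n∣≡∣m-n∣ (suc m) zero    = refl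
∣m⊖n∣≡∣m-n∣ (suc m) (suc n) = trans (cong ℤ.∣_∣ (ℤ.[1+m]⊖[1+n]≡m⊖n m n)) (∣m⊖n∣≡∣m-n∣ m n)

≡ᶻ⇒≡[mod] : ∀ {a b n} → + a ≡ᶻ + b [mod + n ] → a ≡ b [mod n ]
≡ᶻ⇒≡[mod] {a} {b} {n} a≡b = subst (n ∣_)
  (trans (cong ℤ.∣_∣ (ℤ.m-n≡m⊖n a b)) (∣m⊖n∣≡∣m-n∣ a b))
  (ℤ.∣⇒∣ᵤ (difference a≡b))

≡[mod]⇒≡ᶻ : ∀ {a b n} → a ≡ b [mod n ] → + a ≡ᶻ + b [mod + n ]
≡[mod]⇒≡ᶻ {a} {b} {n} a≡b = congruent (ℤ.∣ᵤ⇒∣ {+ n} {+ a - + b} (subst (n ∣_)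
  (sym (trans (cong ℤ.∣_∣ (ℤ.m-n≡m⊖n a b)) (∣m⊖n∣≡∣m-n∣ a b))) a≡b))

euclidsLemmaᶻ : ∀ {p} → Prime p → ∀ i j → + p ∣ᶻ i * j → + p ∣ᶻ i ⊎ + p ∣ᶻ j
euclidsLemmaᶻ {p} pr i j d = Sum.map (ℤ.∣ᵤ⇒∣ {+ p} {i}) (ℤ.∣ᵤ⇒∣ {+ p} {j})
  (euclidsLemma ℤ.∣ i ∣ ℤ.∣ j ∣ pr (subst (p ∣_) (ℤ.abs-* i j) (ℤ.∣⇒∣ᵤ d)))

-- Signs and parity

IsSign : ℤ → Set
IsSign s = s ≡ 1ℤ ⊎ s ≡ -1ℤ

IsSign-* : ∀ {s u} → IsSign s → IsSign u → IsSign (s * u)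
IsSign-* (inj₁ refl) (inj₁ refl) = inj₁ refl
IsSign-* (inj₁ refl) (inj₂ refl) = inj₂ refl
IsSign-* (inj₂ refl) (inj₁ refl) = inj₂ refl
IsSign-* (inj₂ refl) (inj₂ refl) = inj₁ refl

IsSign-neg : ∀ {s} → IsSign s → IsSign (- s)
IsSign-neg (inj₁ refl) = inj₂ refl
IsSign-neg (inj₂ refl) = inj₁ refl

IsSign⇒s*s≡1 : ∀ {s} → IsSign s → s * s ≡ 1ℤ
IsSign⇒s*s≡1 (inj₁ refl) = refl
IsSign⇒s*s≡1 (inj₂ refl) = refl

IsSign⇒odd : ∀ {s} → IsSign s → s ≡ᶻ 1ℤ [mod + 2 ]
IsSign⇒odd (inj₁ refl) = ≡ᶻ-refl
IsSign⇒odd (inj₂ refl) = congruent (divides -1ℤ refl)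

-- The two sides differ by (s - 1)(u - 1), a product of two even numbers. Thus s ↦ s - 1 turns
-- products of signs into sums modulo 4.
IsSign-*-1 : ∀ {s u} → IsSign s → IsSign u → (s - 1ℤ) + (u - 1ℤ) ≡ᶻ s * u - 1ℤ [mod + 4 ]
IsSign-*-1 (inj₁ refl) (inj₁ refl) = ≡ᶻ-refl
IsSign-*-1 (inj₁ refl) (inj₂ refl) = ≡ᶻ-refl
IsSign-*-1 (inj₂ refl) (inj₁ refl) = ≡ᶻ-refl
IsSign-*-1 (inj₂ refl) (inj₂ refl) = congruent (divides -1ℤ refl)

IsSign-unique : ∀ {p s u} → 2 < p → IsSign s → IsSign u → s ≡ᶻ u [mod + p ] → s ≡ u
IsSign-unique 2<p (inj₁ refl) (inj₁ refl) _ = refl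
IsSign-unique 2<p (inj₁ refl) (inj₂ refl) (congruent d) = ⊥-elim (ℕ.<⇒≱ 2<p (∣⇒≤ (ℤ.∣⇒∣ᵤ d)))
IsSign-unique 2<p (inj₂ refl) (inj₁ refl) (congruent d) = ⊥-elim (ℕ.<⇒≱ 2<p (∣⇒≤ (ℤ.∣⇒∣ᵤ d)))
IsSign-unique 2<p (inj₂ refl) (inj₂ refl) _ = refl

-- Since s - 1 is 0 or -2, the weight in front of it matters only modulo 2.
*-sign-1-mod4 : ∀ {s v w} → IsSign s → v ≡ᶻ w [mod + 2 ] →
                v * (s - 1ℤ) ≡ᶻ w * (s - 1ℤ) [mod + 4 ]
*-sign-1-mod4 {v = v} {w} (inj₁ refl) _ = congruent (divides 0ℤ (identity v w))
  where identity : ∀ v w → v * 0ℤ - w * 0ℤ ≡ 0ℤ * + 4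
        identity = solve-∀
*-sign-1-mod4 {v = v} {w} (inj₂ refl) (congruent (divides c eq)) = congruent (divides (- c)
  (trans (identity₁ v w) (trans (cong (_* (- + 2)) eq) (identity₂ c))))
  where identity₁ : ∀ v w → v * (- + 2) - w * (- + 2) ≡ (v - w) * (- + 2)
        identity₁ = solve-∀
        identity₂ : ∀ c → (c * + 2) * (- + 2) ≡ - c * + 4
        identity₂ = solve-∀

≢2* : ∀ {x} → 1ℤ ≢ + 2 * x
≢2* {x} 1≡2x with () ← ℕ.∣1⇒≡1 (ℤ.∣⇒∣ᵤ (divides x (trans 1≡2x (ℤ.*-comm (+ 2) x))))

EvenOrOdd : ℤ → Set
EvenOrOdd z = (∃[ a ] z ≡ + 2 * a) ⊎ (∃[ a ] z ≡ 1ℤ + + 2 * a)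

even-or-odd : ∀ n → EvenOrOdd (+ n)
even-or-odd zero = inj₁ (0ℤ , refl)
even-or-odd (suc n) with even-or-odd n
... | inj₁ (a , eq) = inj₂ (a , cong (λ z → 1ℤ + z) eq)
... | inj₂ (a , eq) = inj₁ (1ℤ + a , trans (cong (λ z → 1ℤ + z) eq) (identity a))
  where identity : ∀ a → 1ℤ + (1ℤ + + 2 * a) ≡ + 2 * (1ℤ + a)
        identity = solve-∀

EvenOrOdd-complement : ∀ {z} → EvenOrOdd z → EvenOrOdd (- (1ℤ + z))
EvenOrOdd-complement (inj₁ (a , refl)) = inj₂ (- (1ℤ + a) , identity a)
  where identity : ∀ a → - (1ℤ + + 2 * a) ≡ 1ℤ + + 2 * - (1ℤ + a)
        identity = solve-∀
EvenOrOdd-complement (inj₂ (a , refl)) = inj₁ (- (1ℤ + a) , identity a)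
  where identity : ∀ a → - (1ℤ + (1ℤ + + 2 * a)) ≡ + 2 * - (1ℤ + a)
        identity = solve-∀

odd*odd≢even : ∀ a u x → (1ℤ + + 2 * a) * (1ℤ + + 2 * u) ≢ + 2 * x
odd*odd≢even a u x eq = ≢2* {x - (a + u + + 2 * a * u)} (begin
  1ℤ                                                                 ≡⟨ identity₁ a u ⟩
  (1ℤ + + 2 * a) * (1ℤ + + 2 * u) - + 2 * (a + u + + 2 * a * u)      ≡⟨ cong (_- + 2 * (a + u + + 2 * a * u)) eq ⟩
  + 2 * x - + 2 * (a + u + + 2 * a * u)                              ≡⟨ identity₂ x (a + u + + 2 * a * u) ⟩
  + 2 * (x - (a + u + + 2 * a * u))                                  ∎)
  where
    open ≡-Reasoning
    identity₁ : ∀ a u → 1ℤ ≡ (1ℤ + + 2 * a) * (1ℤ + + 2 * u) - + 2 * (a + u + + 2 * a * u)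
    identity₁ = solve-∀
    identity₂ : ∀ x y → + 2 * x - + 2 * y ≡ + 2 * (x - y)
    identity₂ = solve-∀

-- a(1 + 2a) is h(h + 1)/2 for h = 2a; modulo 2 the equation reads a ≡ a + 1.
even-parity-contradiction : ∀ a u π μ c →
  a * (1ℤ + + 2 * u) ≢
  - ((1ℤ + + 2 * π) * ((1ℤ + + 2 * μ) * (a * (1ℤ + + 2 * a)) - 1ℤ + + 2 * c))
even-parity-contradiction a u π μ c eq = ≢2* {Y} (begin
  1ℤ                       ≡⟨ identity a u π μ c ⟩
  + 2 * Y - (L - R)        ≡⟨ cong (λ z → + 2 * Y - (z - R)) eq ⟩
  + 2 * Y - (R - R)        ≡⟨ cancel (+ 2 * Y) R ⟩
  + 2 * Y                  ∎)
  where
    open ≡-Reasoning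
    Q = (1ℤ + + 2 * μ) * (a * (1ℤ + + 2 * a)) - 1ℤ + + 2 * c
    Y = a + a * u + a * a + μ * (a * (1ℤ + + 2 * a)) + c + π * Q
    L = a * (1ℤ + + 2 * u)
    R = - ((1ℤ + + 2 * π) * Q)
    identity : ∀ a u π μ c → 1ℤ ≡
      + 2 * (a + a * u + a * a + μ * (a * (1ℤ + + 2 * a)) + c
        + π * ((1ℤ + + 2 * μ) * (a * (1ℤ + + 2 * a)) - 1ℤ + + 2 * c))
      - (a * (1ℤ + + 2 * u)
        - - ((1ℤ + + 2 * π) * ((1ℤ + + 2 * μ) * (a * (1ℤ + + 2 * a)) - 1ℤ + + 2 * c)))
    identity = solve-∀
    cancel : ∀ y r → y - (r - r) ≡ y
    cancel = solve-∀

-- If h is odd, the left side is odd and the right side even. If h = 2a, then K = a(1 + 2a), and a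
-- factor 2 cancels from the equation before parities are compared.
half-parity-contradiction : ∀ {h K} u π μ c → EvenOrOdd h → + 2 * K ≡ h * (1ℤ + h) →
  h * (1ℤ + + 2 * u) ≢ + 2 * - ((1ℤ + + 2 * π) * ((1ℤ + + 2 * μ) * K - 1ℤ + + 2 * c))
half-parity-contradiction u π μ c (inj₂ (a , refl)) 2K eq = odd*odd≢even a u _ eq
half-parity-contradiction {K = K} u π μ c (inj₁ (a , refl)) 2K eq =
  even-parity-contradiction a u π μ c (ℤ.*-cancelˡ-≡ (+ 2) _ _ (begin
    + 2 * (a * (1ℤ + + 2 * u))  ≡⟨ ℤ.*-assoc (+ 2) a (1ℤ + + 2 * u) ⟨
    + 2 * a * (1ℤ + + 2 * u)    ≡⟨ eq ⟩
    + 2 * - ((1ℤ + + 2 * π) * ((1ℤ + + 2 * μ) * K - 1ℤ + + 2 * c))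
      ≡⟨ cong (λ z → + 2 * - ((1ℤ + + 2 * π) * ((1ℤ + + 2 * μ) * z - 1ℤ + + 2 * c))) K≡ ⟩
    + 2 * - ((1ℤ + + 2 * π) * ((1ℤ + + 2 * μ) * (a * (1ℤ + + 2 * a)) - 1ℤ + + 2 * c)) ∎))
  where
    open ≡-Reasoning
    K≡ : K ≡ a * (1ℤ + + 2 * a)
    K≡ = ℤ.*-cancelˡ-≡ (+ 2) _ _ (trans 2K (ℤ.*-assoc (+ 2) a (1ℤ + + 2 * a)))

parity-contradiction : ∀ {h K e} u π μ c → IsSign e → EvenOrOdd h → + 2 * K ≡ h * (1ℤ + h) →
  (1ℤ + + 2 * h - e) * (1ℤ + + 2 * u) ≢
    - (+ 4 * ((1ℤ + + 2 * π) * ((1ℤ + + 2 * μ) * K - 1ℤ + + 2 * c)))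
parity-contradiction {h} {K} u π μ c (inj₁ refl) h-parity 2K eq =
  half-parity-contradiction u π μ c h-parity 2K (ℤ.*-cancelˡ-≡ (+ 2) _ _
    (trans (identity₁ h (1ℤ + + 2 * u)) (trans eq
      (identity₂ ((1ℤ + + 2 * π) * ((1ℤ + + 2 * μ) * K - 1ℤ + + 2 * c))))))
  where
    identity₁ : ∀ h M → + 2 * (h * M) ≡ (1ℤ + + 2 * h - 1ℤ) * M
    identity₁ = solve-∀
    identity₂ : ∀ x → - (+ 4 * x) ≡ + 2 * (+ 2 * - x)
    identity₂ = solve-∀
-- h ↦ -(1 + h) preserves h(1 + h), and 1 + 2π ↦ -(1 + 2π) absorbs the change of sign.
parity-contradiction {h} {K} u π μ c (inj₂ refl) h-parity 2K eq =
  half-parity-contradiction u (- (1ℤ + π)) μ c (EvenOrOdd-complement h-parity)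
    (trans 2K (identity₃ h)) (ℤ.*-cancelˡ-≡ (- + 2) _ _
    (trans (identity₁ h (1ℤ + + 2 * u)) (trans eq
      (identity₂ π ((1ℤ + + 2 * μ) * K - 1ℤ + + 2 * c)))))
  where
    identity₁ : ∀ h M → - + 2 * (- (1ℤ + h) * M) ≡ (1ℤ + + 2 * h - -1ℤ) * M
    identity₁ = solve-∀
    identity₂ : ∀ π x → - (+ 4 * ((1ℤ + + 2 * π) * x)) ≡
                - + 2 * (+ 2 * - ((1ℤ + + 2 * - (1ℤ + π)) * x))
    identity₂ = solve-∀
    identity₃ : ∀ h → h * (1ℤ + h) ≡ - (1ℤ + h) * (1ℤ + - (1ℤ + h))
    identity₃ = solve-∀

-- In this form `odd (odd t)` is 4t + 3, and removing its successor leaves `odd t + odd t`, so p - 1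
-- and its half are available by computation.
odd : ℕ → ℕ
odd n = suc (n ℕ.+ n)

n+n≡n*2 : ∀ n → n ℕ.+ n ≡ n ℕ.* 2
n+n≡n*2 = ℕRing.solve-∀

∤2⇒odd : ∀ {n} → 2 ∤ n → ∃[ k ] n ≡ odd k
∤2⇒odd {zero}        2∤n = ⊥-elim (2∤n (ℕ.divides 0 refl))
∤2⇒odd {suc zero}    2∤n = 0 , refl
∤2⇒odd {suc (suc n)} 2∤n with ∤2⇒odd {n} (λ 2∣n → 2∤n (ℕ.∣m∣n⇒∣m+n (ℕ.divides 1 refl) 2∣n))
... | k , refl = suc k , cong (suc ∘ suc) (sym (ℕ.+-suc k k))

2∤odd : ∀ k → 2 ∤ odd k
2∤odd k d with () ← ℕ.∣1⇒≡1 (ℕ.∣m+n∣m⇒∣n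
  (subst (2 ∣_) (ℕ.+-comm 1 (k ℕ.+ k)) d) (ℕ.divides k (n+n≡n*2 k)))

≡3[mod4]⇒ : ∀ {p} → p ≡ 3 [mod 4 ] → ∃[ t ] p ≡ odd (odd t)
-- For p < 3 the distance to 3 is 3, 2 or 1, positive and less than 4, hence no multiple of 4.
≡3[mod4]⇒ {0} d with s≤s (s≤s (s≤s ())) ← ∣⇒≤ d
≡3[mod4]⇒ {1} d with s≤s (s≤s ()) ← ∣⇒≤ d
≡3[mod4]⇒ {2} d with s≤s () ← ∣⇒≤ d
≡3[mod4]⇒ {suc (suc (suc n))} d with subst (4 ∣_) (ℕ.∣-∣-identityʳ n) d
... | ℕ.divides t refl = t , cong suc (identity t)
  where identity : ∀ t → 2 ℕ.+ t ℕ.* 4 ≡ (1 ℕ.+ (t ℕ.+ t)) ℕ.+ (1 ℕ.+ (t ℕ.+ t))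
        identity = ℕRing.solve-∀

-- With t from p = 4t + 3, this makes (p - 1)/q twice an odd number. From 2 · `odd t` = kq with q
-- odd, 2 divides k, and k/2 is odd because it divides `odd t`.
odd-cofactor : ∀ {q} t → 2 ∤ q → q ∣ odd t ℕ.+ odd t → ∃[ μ ] q ℕ.* odd μ ≡ odd t
odd-cofactor {q} t 2∤q (ℕ.divides k N+N≡kq) with euclidsLemma k q prime[2]
  (ℕ.divides (odd t) (trans (sym N+N≡kq) (n+n≡n*2 (odd t))))
... | inj₂ 2∣q = ⊥-elim (2∤q 2∣q)
... | inj₁ (ℕ.divides m′ refl) = μ , trans (cong (q ℕ.*_) (sym m′≡)) q*m′≡N
  where
    N = odd t
    rearrange : ∀ m q → m ℕ.* 2 ℕ.* q ≡ q ℕ.* m ℕ.* 2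
    rearrange = ℕRing.solve-∀
    q*m′≡N : q ℕ.* m′ ≡ N
    q*m′≡N = ℕ.*-cancelʳ-≡ (q ℕ.* m′) N 2
      (trans (sym (rearrange m′ q)) (trans (sym N+N≡kq) (n+n≡n*2 N)))
    m′-odd : ∃[ μ ] m′ ≡ odd μ
    m′-odd = ∤2⇒odd λ 2∣m′ → 2∤odd t (subst (2 ∣_) q*m′≡N (ℕ.∣n⇒∣m*n q 2∣m′))
    μ = proj₁ m′-odd
    m′≡ = proj₂ m′-odd

-- The Legendre symbol

-- The factor a is kept because Fermat's theorem is used as a^p ≡ a. Euclid's lemma first removes a,
-- then separates x - 1 from x + 1.
square≡1 : ∀ {p a} → Prime p → p ∤ a → ∀ x → + a * (x * x) ≡ᶻ + a [mod + p ] →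
           + p ∣ᶻ x - 1ℤ ⊎ + p ∣ᶻ x - -1ℤ
square≡1 {p} {a} p-prime p∤a x (congruent d) = Sum.[ (λ p∣a → ⊥-elim (p∤a (ℤ.∣⇒∣ᵤ p∣a)))
                                                    , euclidsLemmaᶻ p-prime (x - 1ℤ) (x - -1ℤ) ]′
  (euclidsLemmaᶻ p-prime (+ a) ((x - 1ℤ) * (x - -1ℤ)) (subst (+ p ∣ᶻ_) (identity (+ a) x) d))
  where
    identity : ∀ a x → a * (x * x) - a ≡ a * ((x - 1ℤ) * (x - -1ℤ))
    identity = solve-∀

a^n≡±1 : ∀ {n} → Prime (odd n) → ∀ {a} → odd n ∤ a →
         + odd n ∣ᶻ (+ a) ^ n - 1ℤ ⊎ + odd n ∣ᶻ (+ a) ^ n - -1ℤ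
a^n≡±1 {n} p-prime {a} p∤a = square≡1 p-prime p∤a ((+ a) ^ n) (begin
  + a * ((+ a) ^ n * (+ a) ^ n)  ≡⟨ cong (+ a *_) (ℤ.^-distribˡ-+-* (+ a) n n) ⟨
  (+ a) ^ odd n                  ≈⟨ fermat p-prime a ⟩
  + a                            ∎)
  where open ≡ᶻ-Reasoning (+ odd n)

sign : ∀ {A : Set} → Dec A → ℤ
sign (yes _) = 1ℤ
sign (no _)  = -1ℤ

sign-isSign : ∀ {A} (A? : Dec A) → IsSign (sign A?)
sign-isSign (yes _) = inj₁ refl
sign-isSign (no _)  = inj₂ refl

sign-congruent : ∀ {n x} (n∣x-1? : Dec (n ∣ᶻ x - 1ℤ)) → n ∣ᶻ x - 1ℤ ⊎ n ∣ᶻ x - -1ℤ →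
                 x ≡ᶻ sign n∣x-1? [mod n ]
sign-congruent (yes d) _        = congruent d
sign-congruent (no ¬d) (inj₁ d) = ⊥-elim (¬d d)
sign-congruent (no ¬d) (inj₂ d) = congruent d

module Legendre (t : ℕ) (p-prime : Prime (odd (odd t))) where

  N p : ℕ
  N = odd t
  p = odd N

  2<p : 2 < p
  2<p = s≤s (s≤s (subst (1 ≤_) (sym (ℕ.+-suc (t ℕ.+ t) (t ℕ.+ t))) (s≤s z≤n)))

  abstract
    -- Euler's criterion taken as the definition. Multiples of p get the value -1 instead of 0, so
    -- that every value is a sign; the properties below therefore assume that p does not divide the
    -- arguments.
    χ : ℕ → ℤ
    χ a = sign (+ p ∣ᶻ? (+ a) ^ N - 1ℤ)

    χ-sign : ∀ a → IsSign (χ a)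
    χ-sign a = sign-isSign (+ p ∣ᶻ? (+ a) ^ N - 1ℤ)

    euler : ∀ {a} → p ∤ a → (+ a) ^ N ≡ᶻ χ a [mod + p ]
    euler {a} p∤a = sign-congruent (+ p ∣ᶻ? (+ a) ^ N - 1ℤ)
      (a^n≡±1 {N} p-prime p∤a)

  -- Distinct signs are incongruent modulo p > 2. This reduces each identity for `χ` to a
  -- computation of N-th powers modulo p.
  χ-unique : ∀ {a s} → p ∤ a → IsSign s → (+ a) ^ N ≡ᶻ s [mod + p ] → χ a ≡ s
  χ-unique {a} p∤a s-sign eq =
    IsSign-unique 2<p (χ-sign a) s-sign (≡ᶻ-trans (≡ᶻ-sym (euler p∤a)) eq)

  p∤* : ∀ {a b} → p ∤ a → p ∤ b → p ∤ a ℕ.* b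
  p∤* {a} {b} p∤a p∤b d = Sum.[ p∤a , p∤b ]′ (euclidsLemma a b p-prime d)

  χ-* : ∀ {a b} → p ∤ a → p ∤ b → χ (a ℕ.* b) ≡ χ a * χ b
  χ-* {a} {b} p∤a p∤b = χ-unique (p∤* p∤a p∤b) (IsSign-* (χ-sign a) (χ-sign b)) (begin
    (+ (a ℕ.* b)) ^ N      ≡⟨ cong (_^ N) (ℤ.pos-* a b) ⟩
    (+ a * + b) ^ N        ≡⟨ ^-distribʳ-* (+ a) (+ b) N ⟩
    (+ a) ^ N * (+ b) ^ N  ≈⟨ *-cong (euler p∤a) (euler p∤b) ⟩
    χ a * χ b              ∎)
    where open ≡ᶻ-Reasoning (+ p)

  χ-cong : ∀ {a b} → p ∤ a → p ∤ b → + a ≡ᶻ + b [mod + p ] → χ a ≡ χ b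
  χ-cong {b = b} p∤a p∤b a≡b =
    χ-unique p∤a (χ-sign b) (≡ᶻ-trans (^-congˡ N a≡b) (euler p∤b))

  -- -1 is a nonresidue because N is odd.
  χ-reflect : ∀ {a b} → p ∤ a → p ∤ b → a ℕ.+ b ≡ p → χ a ≡ - χ b
  χ-reflect {a} {b} p∤a p∤b a+b≡p = χ-unique p∤a (IsSign-neg (χ-sign b)) (begin
    (+ a) ^ N              ≈⟨ ^-congˡ {a = + a} { - + b} N (congruent (divides 1ℤ a--b≡p)) ⟩
    (- + b) ^ N            ≡⟨ cong (_^ N) (ℤ.-1*i≡-i (+ b)) ⟨
    (-1ℤ * + b) ^ N        ≡⟨ ^-distribʳ-* -1ℤ (+ b) N ⟩
    -1ℤ ^ N * (+ b) ^ N    ≡⟨ cong (_* (+ b) ^ N) -1^N≡-1 ⟩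
    -1ℤ * (+ b) ^ N        ≈⟨ *-congˡ -1ℤ (euler p∤b) ⟩
    -1ℤ * χ b              ≡⟨ ℤ.-1*i≡-i (χ b) ⟩
    - χ b                  ∎)
    where
      open ≡ᶻ-Reasoning (+ p)
      identity : ∀ a b → a - - b ≡ a + b
      identity = solve-∀
      a--b≡p : + a - - + b ≡ 1ℤ * + p
      a--b≡p = trans (identity (+ a) (+ b)) (trans (sym (ℤ.pos-+ a b)) (trans (cong +_ a+b≡p) (sym (ℤ.*-identityˡ (+ p)))))
      -1^N≡-1 : -1ℤ ^ N ≡ -1ℤ
      -1^N≡-1 = cong (-1ℤ *_) (trans (ℤ.^-distribˡ-+-* -1ℤ t t)
        (trans (sym (^-distribʳ-* -1ℤ -1ℤ t)) (ℤ.^-zeroˡ t)))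

  -- The exponent `suc t` is (p + 1)/4. Since 2(t + 1) = N + 1, the square of the witness is a ·
  -- a^N, which is congruent to a χ(a).
  χ≡1⇒IsQuadraticResidue : ∀ {a} → p ∤ a → χ a ≡ 1ℤ → IsQuadraticResidue p a
  χ≡1⇒IsQuadraticResidue {a} p∤a χa≡1 =
    (λ d → p∤a (subst (p ∣_) (ℕ.∣-∣-identityʳ a) d)) , a ℕ.^ suc t , ≡ᶻ⇒≡[mod] (begin
      + (a ℕ.^ suc t ℕ.* a ℕ.^ suc t)  ≡⟨ ℤ.pos-* (a ℕ.^ suc t) (a ℕ.^ suc t) ⟩
      + (a ℕ.^ suc t) * + (a ℕ.^ suc t) ≡⟨ cong₂ _*_ (pos-^ (suc t)) (pos-^ (suc t)) ⟩
      (+ a * (+ a) ^ t) * (+ a * (+ a) ^ t) ≡⟨ identity (+ a) ((+ a) ^ t) ⟩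
      + a * (+ a * ((+ a) ^ t * (+ a) ^ t)) ≡⟨ cong (λ z → + a * (+ a * z)) (ℤ.^-distribˡ-+-* (+ a) t t) ⟨
      + a * (+ a) ^ N                  ≈⟨ *-congˡ (+ a) (euler p∤a) ⟩
      + a * χ a                        ≡⟨ cong (+ a *_) χa≡1 ⟩
      + a * 1ℤ                         ≡⟨ ℤ.*-identityʳ (+ a) ⟩
      + a                              ∎)
    where
      open ≡ᶻ-Reasoning (+ p)
      identity : ∀ a x → (a * x) * (a * x) ≡ a * (a * (x * x))
      identity = solve-∀
      pos-^ : ∀ k → + (a ℕ.^ k) ≡ (+ a) ^ k
      pos-^ zero    = refl
      pos-^ (suc k) = trans (ℤ.pos-* a (a ℕ.^ k)) (cong (+ a *_) (pos-^ k))

  p∤1 : p ∤ 1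
  p∤1 = 1+n<p⇒p∤1+n (ℕ.<-trans ℕ.≤-refl 2<p)

  χ1≡1 : χ 1 ≡ 1ℤ
  χ1≡1 = χ-unique p∤1 (inj₁ refl) (congruent (divides 0ℤ (cong (_- 1ℤ) (ℤ.^-zeroˡ N))))

  -- Iterates `IsSign-*-1`. That p does not divide the product is carried along, as multiplicativity
  -- of `χ` needs it at each step.
  χ-product-mod4 : ∀ n f → (∀ {i} → i < n → p ∤ f i) →
    p ∤ product (applyUpTo f n) ×
    (∑ n (χ ∘ f) ≡ᶻ + n + (χ (product (applyUpTo f n)) - 1ℤ) [mod + 4 ])
  χ-product-mod4 zero    f p∤f = p∤1 , ≡ᶻ-reflexive (cong (λ s → 0ℤ + (s - 1ℤ)) (sym χ1≡1))
  χ-product-mod4 (suc n) f p∤f with χ-product-mod4 n (f ∘ suc) (p∤f ∘ s≤s)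
  ... | p∤P , S≡ = p∤* p∤f0 p∤P , (begin
    χ (f 0) + ∑ n (χ ∘ f ∘ suc)                  ≈⟨ +-congˡ (χ (f 0)) S≡ ⟩
    χ (f 0) + (+ n + (χ P - 1ℤ))                 ≡⟨ identity (χ (f 0)) (+ n) (χ P - 1ℤ) ⟩
    (1ℤ + + n) + ((χ (f 0) - 1ℤ) + (χ P - 1ℤ))   ≈⟨ +-congˡ (1ℤ + + n) (IsSign-*-1 (χ-sign (f 0)) (χ-sign P)) ⟩
    (1ℤ + + n) + (χ (f 0) * χ P - 1ℤ)            ≡⟨ cong (λ s → (1ℤ + + n) + (s - 1ℤ)) (χ-* p∤f0 p∤P) ⟨
    (1ℤ + + n) + (χ (f 0 ℕ.* P) - 1ℤ)            ∎)
    where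
      open ≡ᶻ-Reasoning (+ 4)
      P = product (applyUpTo (f ∘ suc) n)
      p∤f0 = p∤f (s≤s z≤n)
      identity : ∀ x n z → x + (n + z) ≡ (1ℤ + n) + ((x - 1ℤ) + z)
      identity = solve-∀

  -- Here `P` marks the indices of odd weight. By `*-sign-1-mod4` these count with weight 1 and the
  -- others with weight 0, so the weighted sum sees just the filtered product.
  χ-filter-mod4 : ∀ {P : Pred ℕ 0ℓ} (P? : Decidable P) (G : ℕ → ℕ) n (f : ℕ → ℕ) (w : ℕ → ℤ) →
    (∀ {i} → i < n → p ∤ G (f i)) →
    (∀ {i} → i < n → (P (f i) × w i ≡ᶻ 1ℤ [mod + 2 ]) ⊎ (¬ P (f i) × w i ≡ᶻ 0ℤ [mod + 2 ])) →
    p ∤ product (map G (filter P? (applyUpTo f n))) ×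
    (∑ n (λ i → w i * (χ (G (f i)) - 1ℤ)) ≡ᶻ
      χ (product (map G (filter P? (applyUpTo f n)))) - 1ℤ [mod + 4 ])
  χ-filter-mod4 P? G zero f w p∤ w≡ = p∤1 , ≡ᶻ-reflexive (cong (_- 1ℤ) (sym χ1≡1))
  χ-filter-mod4 P? G (suc n) f w p∤ w≡
    with w≡ (s≤s z≤n) | χ-filter-mod4 P? G n (f ∘ suc) (w ∘ suc) (p∤ ∘ s≤s) (w≡ ∘ s≤s)
  ... | inj₁ (Pf0 , w0≡1) | p∤R , S≡ rewrite filter-accept P? {x = f 0} {xs = applyUpTo (f ∘ suc) n} Pf0 =
    p∤* p∤G p∤R , (begin
      w 0 * (x - 1ℤ) + ∑ n W       ≈⟨ +-cong (*-sign-1-mod4 {v = w 0} (χ-sign (G (f 0))) w0≡1) S≡ ⟩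
      1ℤ * (x - 1ℤ) + (χ R - 1ℤ)   ≡⟨ cong (_+ (χ R - 1ℤ)) (ℤ.*-identityˡ (x - 1ℤ)) ⟩
      (x - 1ℤ) + (χ R - 1ℤ)        ≈⟨ IsSign-*-1 (χ-sign (G (f 0))) (χ-sign R) ⟩
      x * χ R - 1ℤ                 ≡⟨ cong (_- 1ℤ) (χ-* p∤G p∤R) ⟨
      χ (G (f 0) ℕ.* R) - 1ℤ       ∎)
    where
      open ≡ᶻ-Reasoning (+ 4)
      x = χ (G (f 0))
      W = λ i → w (suc i) * (χ (G (f (suc i))) - 1ℤ)
      R = product (map G (filter P? (applyUpTo (f ∘ suc) n)))
      p∤G = p∤ (s≤s z≤n)
  ... | inj₂ (¬Pf0 , w0≡0) | p∤R , S≡ rewrite filter-reject P? {x = f 0} {xs = applyUpTo (f ∘ suc) n} ¬Pf0 =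
    p∤R , (begin
      w 0 * (x - 1ℤ) + ∑ n W       ≈⟨ +-cong (*-sign-1-mod4 {v = w 0} (χ-sign (G (f 0))) w0≡0) S≡ ⟩
      0ℤ + (χ R - 1ℤ)              ≡⟨ ℤ.+-identityˡ (χ R - 1ℤ) ⟩
      χ R - 1ℤ                     ∎)
    where
      open ≡ᶻ-Reasoning (+ 4)
      x = χ (G (f 0))
      W = λ i → w (suc i) * (χ (G (f (suc i))) - 1ℤ)
      R = product (map G (filter P? (applyUpTo (f ∘ suc) n)))

-- Blocks

module Blocks (t h μ : ℕ) (p-prime : Prime (odd (odd t))) (q*m′≡N : odd h ℕ.* odd μ ≡ odd t) where

  open Legendre t p-prime

  -- The block length (p - 1)/q is `m`; its half `m′` is odd.
  q m′ m : ℕ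
  q  = odd h
  m′ = odd μ
  m  = m′ ℕ.+ m′

  q*m≡N+N : q ℕ.* m ≡ N ℕ.+ N
  q*m≡N+N = trans (ℕ.*-distribˡ-+ q m′ m′) (cong₂ ℕ._+_ q*m′≡N q*m′≡N)

  m*q≡N+N : m ℕ.* q ≡ N ℕ.+ N
  m*q≡N+N = trans (ℕ.*-comm m q) q*m≡N+N

  -- Stated for any factorisation of p - 1, since 1, ..., p - 1 is cut both into q blocks of length
  -- m and into m blocks of length q.
  block-bound : ∀ {a b k i} → a ℕ.* b ≡ N ℕ.+ N → k < a → i < b → p ∤ suc (k ℕ.* b ℕ.+ i)
  block-bound {a} {b} {k} {i} a*b≡N+N k<a i<b = 1+n<p⇒p∤1+n (s≤s (begin-strict
    k ℕ.* b ℕ.+ i   <⟨ ℕ.+-monoʳ-< (k ℕ.* b) i<b ⟩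
    k ℕ.* b ℕ.+ b   ≡⟨ ℕ.+-comm (k ℕ.* b) b ⟩
    suc k ℕ.* b     ≤⟨ ℕ.*-monoˡ-≤ b k<a ⟩
    a ℕ.* b         ≡⟨ a*b≡N+N ⟩
    N ℕ.+ N         ∎))
    where open ℕ.≤-Reasoning

  p∤q : p ∤ q
  p∤q = 1+n<p⇒p∤1+n (s≤s (begin
    q             ≤⟨ ℕ.m≤m*n q m ⟩
    q ℕ.* m       ≡⟨ q*m≡N+N ⟩
    N ℕ.+ N       ∎))
    where open ℕ.≤-Reasoning

  -- Summing χ(r)r in two ways

  F : ℕ → ℤ
  F i = χ (suc i) * + suc i

  M : ℤ
  M = ∑ (N ℕ.+ N) F

  S : ℕ → ℤ
  S k = ∑ m (λ i → χ (suc (k ℕ.* m ℕ.+ i)))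

  W : ℤ
  W = ∑ q (λ k → + k * S k)

  e : ℤ
  e = χ q

  M-blocks : M ≡ ∑ q (λ k → ∑ m (λ i → F (k ℕ.* m ℕ.+ i)))
  M-blocks = trans (cong (λ n → ∑ n F) (sym q*m≡N+N)) (∑-blocks q m F)

  -- As (i, k) varies, r = iq + k + 1 runs through 1, …, p - 1 just as j = k′m + i + 1 does.
  multiply-by-q : ∀ i k k′ → suc (k ℕ.+ k′) ≡ q →
    k′ ℕ.* p ℕ.+ suc (i ℕ.* q ℕ.+ k) ≡ q ℕ.* suc (k′ ℕ.* m ℕ.+ i)
  multiply-by-q i k k′ k+k′ = begin
    k′ ℕ.* p ℕ.+ suc (i ℕ.* q ℕ.+ k)                ≡⟨ cong (λ n → k′ ℕ.* suc n ℕ.+ suc (i ℕ.* q ℕ.+ k)) q*m≡N+N ⟨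
    k′ ℕ.* suc (q ℕ.* m) ℕ.+ suc (i ℕ.* q ℕ.+ k)    ≡⟨ identity i k k′ q m ⟩
    suc (k ℕ.+ k′) ℕ.+ q ℕ.* (k′ ℕ.* m ℕ.+ i)       ≡⟨ cong (ℕ._+ q ℕ.* (k′ ℕ.* m ℕ.+ i)) k+k′ ⟩
    q ℕ.+ q ℕ.* (k′ ℕ.* m ℕ.+ i)                    ≡⟨ ℕ.*-suc q (k′ ℕ.* m ℕ.+ i) ⟨
    q ℕ.* suc (k′ ℕ.* m ℕ.+ i)                      ∎
    where
      open ≡-Reasoning
      identity : ∀ i k k′ q m → k′ ℕ.* (1 ℕ.+ q ℕ.* m) ℕ.+ (1 ℕ.+ (i ℕ.* q ℕ.+ k)) ≡
                  (1 ℕ.+ (k ℕ.+ k′)) ℕ.+ q ℕ.* (k′ ℕ.* m ℕ.+ i)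
      identity = ℕRing.solve-∀

  -- From r = qj - k′p follows χ(r) = χ(q)χ(j). Expanding χ(r)r leaves one multiple of χ(j)j, which
  -- will sum to M, and one of k′χ(j), which will sum to W.
  F-remainder : ∀ i k k′ → i < m → suc (k ℕ.+ k′) ≡ q →
    F (i ℕ.* q ℕ.+ k) ≡
    (e * + q) * F (k′ ℕ.* m ℕ.+ i) + (- (e * + p) * + k′) * χ (suc (k′ ℕ.* m ℕ.+ i))
  F-remainder i k k′ i<m k+k′ = begin
    χ r * + r                           ≡⟨ cong₂ _*_ χr≡ r≡ ⟩
    (e * χ j) * (+ q * + j - + k′ * + p) ≡⟨ identity e (χ j) (+ q) (+ j) (+ k′) (+ p) ⟩
    (e * + q) * (χ j * + j) + (- (e * + p) * + k′) * χ j ∎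
    where
      open ≡-Reasoning
      j = suc (k′ ℕ.* m ℕ.+ i)
      r = suc (i ℕ.* q ℕ.+ k)
      k<q : k < q
      k<q = subst (k <_) k+k′ (s≤s (ℕ.m≤m+n k k′))
      k′<q : k′ < q
      k′<q = subst (k′ <_) k+k′ (s≤s (ℕ.m≤n+m k′ k))
      p∤j : p ∤ j
      p∤j = block-bound q*m≡N+N k′<q i<m
      p∤r : p ∤ r
      p∤r = block-bound m*q≡N+N i<m k<q
      k′p+r≡qj : + k′ * + p + + r ≡ + q * + j
      k′p+r≡qj = begin
        + k′ * + p + + r      ≡⟨ cong (_+ + r) (ℤ.pos-* k′ p) ⟨
        + (k′ ℕ.* p) + + r    ≡⟨ ℤ.pos-+ (k′ ℕ.* p) r ⟨
        + (k′ ℕ.* p ℕ.+ r)    ≡⟨ cong +_ (multiply-by-q i k k′ k+k′) ⟩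
        + (q ℕ.* j)           ≡⟨ ℤ.pos-* q j ⟩
        + q * + j             ∎
      isolate : ∀ x y → y ≡ (x + y) - x
      isolate = solve-∀
      r≡ : + r ≡ + q * + j - + k′ * + p
      r≡ = trans (isolate (+ k′ * + p) (+ r)) (cong (_- + k′ * + p) k′p+r≡qj)
      difference-r : ∀ x k p → (x - k * p) - x ≡ - k * p
      difference-r = solve-∀
      χr≡ : χ r ≡ e * χ j
      χr≡ = trans (χ-cong p∤r (p∤* p∤q p∤j) (congruent (divides (- + k′)
              (trans (cong₂ _-_ r≡ (ℤ.pos-* q j)) (difference-r (+ q * + j) (+ k′) (+ p))))))
            (χ-* p∤q p∤j)
      identity : ∀ e x q j k p →
        (e * x) * (q * j - k * p) ≡ (e * q) * (x * j) + (- (e * p) * k) * x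
      identity = solve-∀

  -- The sum over r is cut into m rows of length q. Reversing each row replaces k by k′ = q - 1 - k,
  -- and exchanging the two sums then regroups the terms into the q blocks of length m that contain
  -- j.
  M≡e[qM-pW] : M ≡ (e * + q) * M + - (e * + p) * W
  M≡e[qM-pW] = begin
    ∑ (N ℕ.+ N) F                                     ≡⟨ cong (λ n → ∑ n F) m*q≡N+N ⟨
    ∑ (m ℕ.* q) F                                     ≡⟨ ∑-blocks m q F ⟩
    ∑ m (λ i → ∑ q (λ k → F (i ℕ.* q ℕ.+ k)))         ≡⟨ ∑-cong m (λ i i<m → ∑-reverse q (λ k k′ → F-remainder i k k′ i<m)) ⟩
    ∑ m (λ i → ∑ q (λ k → a * A k i + b k * B k i))   ≡⟨ ∑-swap m q (λ i k → a * A k i + b k * B k i) ⟩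
    ∑ q (λ k → ∑ m (λ i → a * A k i + b k * B k i))   ≡⟨ ∑-cong q (λ k _ → ∑-linear m a (b k) (A k) (B k)) ⟩
    ∑ q (λ k → a * ∑ m (A k) + b k * S k)             ≡⟨ ∑-cong q (λ k _ → cong (λ z → a * ∑ m (A k) + z) (ℤ.*-assoc (- (e * + p)) (+ k) (S k))) ⟩
    ∑ q (λ k → a * ∑ m (A k) + - (e * + p) * (+ k * S k)) ≡⟨ ∑-linear q a (- (e * + p)) (λ k → ∑ m (A k)) (λ k → + k * S k) ⟩
    a * ∑ q (λ k → ∑ m (A k)) + - (e * + p) * W       ≡⟨ cong (λ z → a * z + - (e * + p) * W) M-blocks ⟨
    a * M + - (e * + p) * W                           ∎
    where
      open ≡-Reasoning
      a = e * + q
      b : ℕ → ℤ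
      b k = - (e * + p) * + k
      A B : ℕ → ℕ → ℤ
      A k i = F (k ℕ.* m ℕ.+ i)
      B k i = χ (suc (k ℕ.* m ℕ.+ i))

  -- Multiplying the preceding relation by e and using e² = 1 gives eM = qM - pW.
  [q-e]M≡pW : (+ q - e) * M ≡ + p * W
  [q-e]M≡pW = begin
    (+ q - e) * M                                            ≡⟨ identity₁ (+ q) e M ⟩
    + q * M - e * M                                          ≡⟨ cong (λ z → + q * M - e * z) M≡e[qM-pW] ⟩
    + q * M - e * ((e * + q) * M + - (e * + p) * W)          ≡⟨ identity₂ (+ q) (+ p) e M W ⟩
    + q * M - (e * e) * (+ q * M - + p * W)                  ≡⟨ cong (λ s → + q * M - s * (+ q * M - + p * W)) (IsSign⇒s*s≡1 (χ-sign q)) ⟩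
    + q * M - 1ℤ * (+ q * M - + p * W)                       ≡⟨ identity₃ (+ q * M) (+ p * W) ⟩
    + p * W                                                  ∎
    where
      open ≡-Reasoning
      identity₁ : ∀ q e M → (q - e) * M ≡ q * M - e * M
      identity₁ = solve-∀
      identity₂ : ∀ q p e M W → q * M - e * ((e * q) * M + - (e * p) * W) ≡ q * M - (e * e) * (q * M - p * W)
      identity₂ = solve-∀
      identity₃ : ∀ x y → x - 1ℤ * (x - y) ≡ y
      identity₃ = solve-∀

  -- The map j ↦ p - j carries block k onto block 2h - k in reverse order and changes the sign of
  -- `χ`.
  S-reflect : ∀ k k′ → k ℕ.+ k′ ≡ h ℕ.+ h → S k ≡ - S k′
  S-reflect k k′ k+k′ = begin
    S k                                              ≡⟨ ∑-reverse m reflect ⟩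
    ∑ m (λ i → -1ℤ * χ (suc (k′ ℕ.* m ℕ.+ i)))       ≡⟨ ∑-* m -1ℤ (λ i → χ (suc (k′ ℕ.* m ℕ.+ i))) ⟩
    -1ℤ * S k′                                       ≡⟨ ℤ.-1*i≡-i (S k′) ⟩
    - S k′                                           ∎
    where
      open ≡-Reasoning
      identity : ∀ k k′ i i′ m → (1 ℕ.+ (k ℕ.* m ℕ.+ i)) ℕ.+ (1 ℕ.+ (k′ ℕ.* m ℕ.+ i′)) ≡
                 1 ℕ.+ ((1 ℕ.+ (i ℕ.+ i′)) ℕ.+ (k ℕ.+ k′) ℕ.* m)
      identity = ℕRing.solve-∀
      reflect : ∀ i i′ → suc (i ℕ.+ i′) ≡ m →
        χ (suc (k ℕ.* m ℕ.+ i)) ≡ -1ℤ * χ (suc (k′ ℕ.* m ℕ.+ i′))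
      reflect i i′ i+i′ = trans
        (χ-reflect
          (block-bound q*m≡N+N (s≤s (subst (k ≤_) k+k′ (ℕ.m≤m+n k k′))) (subst (i <_) i+i′ (s≤s (ℕ.m≤m+n i i′))))
          (block-bound q*m≡N+N (s≤s (subst (k′ ≤_) k+k′ (ℕ.m≤n+m k′ k))) (subst (i′ <_) i+i′ (s≤s (ℕ.m≤n+m i′ i))))
          (begin
            suc (k ℕ.* m ℕ.+ i) ℕ.+ suc (k′ ℕ.* m ℕ.+ i′)       ≡⟨ identity k k′ i i′ m ⟩
            suc (suc (i ℕ.+ i′) ℕ.+ (k ℕ.+ k′) ℕ.* m)          ≡⟨ cong₂ (λ x y → suc (x ℕ.+ y ℕ.* m)) i+i′ k+k′ ⟩
            suc (q ℕ.* m)                                       ≡⟨ cong suc q*m≡N+N ⟩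
            p                                                   ∎))
        (sym (ℤ.-1*i≡-i _))

  V : ℤ
  V = ∑ h (λ k → (+ h - + k) * S k)

  -- The middle block is its own mirror image, so S(h) = 0. For k < h, blocks k and 2h - k together
  -- contribute kS(k) - (2h - k)S(k) = -2(h - k)S(k).
  W≡-2V : W ≡ - + 2 * V
  W≡-2V = begin
    ∑ (suc (h ℕ.+ h)) f                            ≡⟨ cong (λ n → ∑ n f) (ℕ.+-suc h h) ⟨
    ∑ (h ℕ.+ suc h) f                              ≡⟨ ∑-split h (suc h) f ⟩
    ∑ h f + (f (h ℕ.+ 0) + ∑ h (λ i → f (h ℕ.+ suc i))) ≡⟨ cong₂ (λ x y → ∑ h f + (x + y)) f[h]≡0 (∑-reverse h upper) ⟩
    ∑ h f + (0ℤ + ∑ h g)                           ≡⟨ cong (λ z → ∑ h f + z) (ℤ.+-identityˡ (∑ h g)) ⟩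
    ∑ h f + ∑ h g                                  ≡⟨ ∑-+ h f g ⟨
    ∑ h (λ k → f k + g k)                          ≡⟨ ∑-cong h (λ k _ → identity₂ (+ h) (+ k) (S k)) ⟩
    ∑ h (λ k → - + 2 * ((+ h - + k) * S k))        ≡⟨ ∑-* h (- + 2) (λ k → (+ h - + k) * S k) ⟩
    - + 2 * V                                      ∎
    where
      open ≡-Reasoning
      f g : ℕ → ℤ
      f k = + k * S k
      g k = ((+ h + + h) - + k) * - S k
      identity₁ : ∀ x y → x ≡ (x + y) - y
      identity₁ = solve-∀
      identity₂ : ∀ h k s → k * s + ((h + h) - k) * - s ≡ - + 2 * ((h - k) * s)
      identity₂ = solve-∀
      identity₃ : ∀ s → + 2 * s ≡ s - - s
      identity₃ = solve-∀
      S[h]≡0 : S h ≡ 0ℤ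
      S[h]≡0 = ℤ.*-cancelˡ-≡ (+ 2) _ _ (trans (identity₃ (S h))
        (ℤ.i≡j⇒i-j≡0 (S-reflect h h refl)))
      f[h]≡0 : f (h ℕ.+ 0) ≡ 0ℤ
      f[h]≡0 = trans (cong f (ℕ.+-identityʳ h)) (trans (cong (+ h *_) S[h]≡0) (ℤ.*-zeroʳ (+ h)))
      upper : ∀ i k → suc (i ℕ.+ k) ≡ h → f (h ℕ.+ suc i) ≡ g k
      upper i k i+k = cong₂ _*_
        (trans (identity₁ (+ (h ℕ.+ suc i)) (+ k))
          (cong (_- + k) (trans (sym (ℤ.pos-+ (h ℕ.+ suc i) k)) (trans (cong +_ h+i+k) (ℤ.pos-+ h h)))))
        (S-reflect (h ℕ.+ suc i) k h+i+k)
        where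
          h+i+k : h ℕ.+ suc i ℕ.+ k ≡ h ℕ.+ h
          h+i+k = trans (ℕ.+-assoc h (suc i) k) (cong (h ℕ.+_) i+k)

  -- The products and the index set of the statement

  [k*2N]/q≡k*m : ∀ k → k ℕ.* (N ℕ.+ N) ℕ./ q ≡ k ℕ.* m
  [k*2N]/q≡k*m k = begin
    k ℕ.* (N ℕ.+ N) ℕ./ q  ≡⟨ cong (λ n → k ℕ.* n ℕ./ q) m*q≡N+N ⟨
    k ℕ.* (m ℕ.* q) ℕ./ q  ≡⟨ cong (ℕ._/ q) (ℕ.*-assoc k m q) ⟨
    k ℕ.* m ℕ.* q ℕ./ q    ≡⟨ m*n/n≡m (k ℕ.* m) q ⟩
    k ℕ.* m                ∎
    where open ≡-Reasoning

  Π≡block : ∀ k → Π q p (suc k) ≡ product (applyUpTo (λ i → suc (k ℕ.* m ℕ.+ i)) m)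
  Π≡block k = begin
    product (interval (k ℕ.* (N ℕ.+ N) ℕ./ q ℕ.+ 1) (suc k ℕ.* (N ℕ.+ N) ℕ./ q))
      ≡⟨ cong₂ (λ x y → product (interval (x ℕ.+ 1) y)) ([k*2N]/q≡k*m k) ([k*2N]/q≡k*m (suc k)) ⟩
    product (interval (k ℕ.* m ℕ.+ 1) (suc k ℕ.* m))
      -- With the 1 in front, a successor cancels in the length `suc b ∸ a` of the interval, leaving
      -- exactly m.
      ≡⟨ cong (λ x → product (interval x (suc k ℕ.* m))) (ℕ.+-comm (k ℕ.* m) 1) ⟩
    product (applyUpTo (λ i → suc (k ℕ.* m ℕ.+ i)) (m ℕ.+ k ℕ.* m ℕ.∸ k ℕ.* m))
      ≡⟨ cong (λ n → product (applyUpTo (λ i → suc (k ℕ.* m ℕ.+ i)) n)) (ℕ.m+n∸n≡m m (k ℕ.* m)) ⟩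
    product (applyUpTo (λ i → suc (k ℕ.* m ℕ.+ i)) m) ∎
    where open ≡-Reasoning

  indices≡ : indices q ≡ filter (λ k → (suc h ℕ.∸ k) ≡? 1 [mod 2 ]) (applyUpTo suc h)
  indices≡ = cong₂ (λ a b → filter (λ k → (a ℕ.∸ k) ≡? 1 [mod 2 ]) (interval 1 b))
    (trans (cong (ℕ._/ 2) (identity₁ h)) (m*n/n≡m (suc h) 2))
    (trans (cong (ℕ._/ 2) (n+n≡n*2 h)) (m*n/n≡m h 2))
    where
      identity₁ : ∀ h → (1 ℕ.+ (h ℕ.+ h)) ℕ.+ 1 ≡ (1 ℕ.+ h) ℕ.* 2
      identity₁ = ℕRing.solve-∀

  block-mod4 : ∀ {k} → k < h →
    p ∤ Π q p (suc k) × (S k ≡ᶻ + m + (χ (Π q p (suc k)) - 1ℤ) [mod + 4 ])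
  block-mod4 {k} k<h = subst (λ P → p ∤ P × (S k ≡ᶻ + m + (χ P - 1ℤ) [mod + 4 ]))
    (sym (Π≡block k))
    (χ-product-mod4 m (λ i → suc (k ℕ.* m ℕ.+ i))
      (block-bound q*m≡N+N (ℕ.<-≤-trans k<h (ℕ.≤-trans (ℕ.m≤m+n h h) (ℕ.n≤1+n (h ℕ.+ h))))))

  -- The statement counts blocks from 1 and `S` counts them from 0. As (q + 1)/2 - (k + 1) = h - k,
  -- the filter keeps exactly the blocks of odd weight in `V`.
  weight-parity : ∀ {k} → k < h →
    ((suc h ℕ.∸ suc k ≡ 1 [mod 2 ]) × (+ h - + k ≡ᶻ 1ℤ [mod + 2 ])) ⊎
    (¬ (suc h ℕ.∸ suc k ≡ 1 [mod 2 ]) × (+ h - + k ≡ᶻ 0ℤ [mod + 2 ]))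
  weight-parity {k} k<h
    rewrite trans (ℤ.m-n≡m⊖n h k) (ℤ.⊖-≥ (ℕ.<⇒≤ k<h)) with even-or-odd (h ℕ.∸ k)
  ... | inj₁ (a , eq) = inj₂ ((λ d → 1≢0 (≡ᶻ-trans (≡ᶻ-sym (≡[mod]⇒≡ᶻ d)) ≡0)) , ≡0)
    where
      identity : ∀ a → + 2 * a - 0ℤ ≡ a * + 2
      identity = solve-∀
      ≡0 : + (h ℕ.∸ k) ≡ᶻ 0ℤ [mod + 2 ]
      ≡0 = congruent (divides a (trans (cong (_- 0ℤ) eq) (identity a)))
      1≢0 : ¬ (1ℤ ≡ᶻ 0ℤ [mod + 2 ])
      1≢0 (congruent (divides x eq′)) = ≢2* (trans eq′ (ℤ.*-comm x (+ 2)))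
  ... | inj₂ (a , eq) = inj₁ (≡ᶻ⇒≡[mod] ≡1 , ≡1)
    where
      identity : ∀ a → (1ℤ + + 2 * a) - 1ℤ ≡ a * + 2
      identity = solve-∀
      ≡1 : + (h ℕ.∸ k) ≡ᶻ 1ℤ [mod + 2 ]
      ≡1 = congruent (divides a (trans (cong (_- 1ℤ) eq) (identity a)))

  -- The total weight h(h + 1)/2, pinned down by its double to avoid a division.
  K : ℤ
  K = ∑ h (λ k → + h - + k)

  2K≡h[1+h] : + 2 * K ≡ + h * (1ℤ + + h)
  2K≡h[1+h] = trans (cong (+ 2 *_) (∑-reverse h reversed)) (2*∑-suc h)
    where
      identity : ∀ x y → (x + y) - x ≡ y
      identity = solve-∀
      reversed : ∀ i j → suc (i ℕ.+ j) ≡ h → + h - + i ≡ + suc j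
      reversed i j eq = trans (cong (_- + i) (trans (cong +_ (trans (sym eq) (sym (ℕ.+-suc i j)))) (ℤ.pos-+ i (suc j))))
        (identity (+ i) (+ suc j))

  ∏Π≡ : ∏Π q p ≡ product (map (Π q p) (filter (λ k → (suc h ℕ.∸ k) ≡? 1 [mod 2 ]) (applyUpTo suc h)))
  ∏Π≡ = cong (λ ks → product (map (Π q p) ks)) indices≡

  -- Each S(k) is m + (χ(Π) - 1) modulo 4, with Π the product of its block. The constant parts add
  -- up to mK, and the sign parts are handled by `χ-filter-mod4`.
  V-mod4 : p ∤ ∏Π q p × (V ≡ᶻ + m * K + (χ (∏Π q p) - 1ℤ) [mod + 4 ])
  V-mod4 = subst (λ P → p ∤ P × (V ≡ᶻ + m * K + (χ P - 1ℤ) [mod + 4 ])) (sym ∏Π≡)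
    (proj₁ filtered , (begin
      ∑ h (λ k → w k * S k)                   ≈⟨ ∑-cong-≡ᶻ h (λ k k<h → *-congˡ (w k) (proj₂ (block-mod4 k<h))) ⟩
      ∑ h (λ k → w k * (+ m + x k))           ≡⟨ ∑-cong h (λ k _ → identity (w k) (+ m) (x k)) ⟩
      ∑ h (λ k → + m * w k + 1ℤ * (w k * x k)) ≡⟨ ∑-linear h (+ m) 1ℤ w (λ k → w k * x k) ⟩
      + m * K + 1ℤ * ∑ h (λ k → w k * x k)    ≡⟨ cong (λ z → + m * K + z) (ℤ.*-identityˡ (∑ h (λ k → w k * x k))) ⟩
      + m * K + ∑ h (λ k → w k * x k)         ≈⟨ +-congˡ (+ m * K) (proj₂ filtered) ⟩
      + m * K + (χ (product (map (Π q p) (filter (λ k → (suc h ℕ.∸ k) ≡? 1 [mod 2 ]) (applyUpTo suc h)))) - 1ℤ) ∎))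
    where
      open ≡ᶻ-Reasoning (+ 4)
      w x : ℕ → ℤ
      w k = + h - + k
      x k = χ (Π q p (suc k)) - 1ℤ
      identity : ∀ w m x → w * (m + x) ≡ m * w + 1ℤ * (w * x)
      identity = solve-∀
      filtered = χ-filter-mod4 (λ k → (suc h ℕ.∸ k) ≡? 1 [mod 2 ]) (Π q p) h suc w
        (λ k<h → proj₁ (block-mod4 k<h)) weight-parity

  -- Signs are odd, so M has the parity of 1 + ... + (p - 1) = pN, a product of odd numbers.
  M-odd : M ≡ᶻ 1ℤ [mod + 2 ]
  M-odd = begin
    ∑ (N ℕ.+ N) F                           ≈⟨ ∑-cong-≡ᶻ (N ℕ.+ N) (λ i _ → *-cong (IsSign⇒odd (χ-sign (suc i))) (≡ᶻ-refl {a = + suc i})) ⟩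
    ∑ (N ℕ.+ N) (λ i → 1ℤ * + suc i)        ≡⟨ ∑-* (N ℕ.+ N) 1ℤ (λ i → + suc i) ⟩
    1ℤ * T                                  ≡⟨ ℤ.*-identityˡ T ⟩
    -- In terms of t, pN - 1 = (1 + 2t)(3 + 4t) - 1 = 2(1 + 5t + 4t²).
    T                                       ≈⟨ congruent (divides (1ℤ + + 5 * + t + + 4 * + t * + t) (trans (cong (_- 1ℤ) T≡) (identity₂ (+ t)))) ⟩
    1ℤ                                      ∎
    where
      open ≡ᶻ-Reasoning (+ 2)
      T = ∑ (N ℕ.+ N) (λ i → + suc i)
      pos-N+N : + (N ℕ.+ N) ≡ + 2 * (1ℤ + + 2 * + t)
      pos-N+N = trans (ℤ.pos-+ N N) (trans (cong (λ z → (1ℤ + z) + (1ℤ + z)) (ℤ.pos-+ t t)) (identity₃ (+ t)))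
        where identity₃ : ∀ t → (1ℤ + (t + t)) + (1ℤ + (t + t)) ≡ + 2 * (1ℤ + + 2 * t)
              identity₃ = solve-∀
      T≡ : T ≡ (1ℤ + + 2 * + t) * (+ 3 + + 4 * + t)
      T≡ = ℤ.*-cancelˡ-≡ (+ 2) _ _ (trans (2*∑-suc (N ℕ.+ N))
        (trans (cong (λ n → n * (1ℤ + n)) pos-N+N) (identity₁ (+ t))))
        where identity₁ : ∀ t → (+ 2 * (1ℤ + + 2 * t)) * (1ℤ + + 2 * (1ℤ + + 2 * t)) ≡
                          + 2 * ((1ℤ + + 2 * t) * (+ 3 + + 4 * t))
              identity₁ = solve-∀
      identity₂ : ∀ t → (1ℤ + + 2 * t) * (+ 3 + + 4 * t) - 1ℤ ≡ (1ℤ + + 5 * t + + 4 * t * t) * + 2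
      identity₂ = solve-∀

  χ[∏Π]≢-1 : V ≡ᶻ + m * K + (χ (∏Π q p) - 1ℤ) [mod + 4 ] → M ≡ᶻ 1ℤ [mod + 2 ] →
             χ (∏Π q p) ≢ -1ℤ
  χ[∏Π]≢-1 (congruent (divides c V≡)) (congruent (divides u M≡)) χ≡-1 =
    -- The parameters are read off from q = 1 + 2h, M = 1 + 2u, p = 1 + 2N and m′ = 1 + 2μ. With χ =
    -- -1 the congruence becomes V = 2(m′K - 1 + 2c), whence -2pV = -4p(m′K - 1 + 2c).
    parity-contradiction u (+ N) (+ μ) c (χ-sign q) (even-or-odd h) 2K≡h[1+h] (begin
      (1ℤ + + 2 * + h - e) * (1ℤ + + 2 * u) ≡⟨ cong₂ (λ x y → (x - e) * y) (pos-odd h) M≡′ ⟨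
      (+ q - e) * M                          ≡⟨ [q-e]M≡pW ⟩
      + p * W                                ≡⟨ cong (+ p *_) W≡-2V ⟩
      + p * (- + 2 * V)                      ≡⟨ cong₂ (λ x y → x * (- + 2 * y)) (pos-odd N) V≡′ ⟩
      (1ℤ + + 2 * + N) * (- + 2 * ((((1ℤ + + 2 * + μ) + (1ℤ + + 2 * + μ)) * K + (-1ℤ - 1ℤ)) + c * + 4))
                                             ≡⟨ identity (1ℤ + + 2 * + N) (1ℤ + + 2 * + μ) K c ⟩
      - (+ 4 * ((1ℤ + + 2 * + N) * ((1ℤ + + 2 * + μ) * K - 1ℤ + + 2 * c))) ∎)
    where
      open ≡-Reasoning
      add-back : ∀ x y → x ≡ y + (x - y)
      add-back = solve-∀
      pos-odd : ∀ n → + odd n ≡ 1ℤ + + 2 * + n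
      pos-odd n = cong (λ z → 1ℤ + z) (trans (ℤ.pos-+ n n) (double (+ n)))
        where double : ∀ n → n + n ≡ + 2 * n
              double = solve-∀
      M≡′ : M ≡ 1ℤ + + 2 * u
      M≡′ = trans (add-back M 1ℤ) (cong (λ z → 1ℤ + z) (trans M≡ (ℤ.*-comm u (+ 2))))
      V≡′ : V ≡ (((1ℤ + + 2 * + μ) + (1ℤ + + 2 * + μ)) * K + (-1ℤ - 1ℤ)) + c * + 4
      V≡′ = trans (add-back V (+ m * K + (χ (∏Π q p) - 1ℤ))) (cong₂ _+_
        (cong₂ (λ x y → x * K + (y - 1ℤ)) (trans (ℤ.pos-+ m′ m′) (cong₂ _+_ (pos-odd μ) (pos-odd μ))) χ≡-1) V≡)
      identity : ∀ p m K c → p * (- + 2 * (((m + m) * K + (-1ℤ - 1ℤ)) + c * + 4)) ≡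
                 - (+ 4 * (p * (m * K - 1ℤ + + 2 * c)))
      identity = solve-∀

  ∏Π-isQuadraticResidue : IsQuadraticResidue p (∏Π q p)
  ∏Π-isQuadraticResidue with χ-sign (∏Π q p)
  ... | inj₁ χ≡1  = χ≡1⇒IsQuadraticResidue (proj₁ V-mod4) χ≡1
  ... | inj₂ χ≡-1 = ⊥-elim (χ[∏Π]≢-1 (proj₂ V-mod4) M-odd χ≡-1)

theorem1 : (q : ℕ) (q-prime : Prime q) → ¬ (2 ∣ q) →
    (p : ℕ) → Prime p → p ≡ 3 [mod 4 ] → p ≡ 1 [mod q ] →
    IsQuadraticResidue p (∏Π q {{prime⇒nonZero q-prime}} p)
theorem1 q q-prime 2∤q p p-prime p≡3 p≡1 with ∤2⇒odd 2∤q | ≡3[mod4]⇒ {p} p≡3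
... | h , refl | t , refl with odd-cofactor t 2∤q (subst (q ∣_) (ℕ.∣-∣-identityʳ _) p≡1)
...   | μ , q*m′≡N = Blocks.∏Π-isQuadraticResidue t h μ p-prime q*m′≡N
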